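{- Let $D=(V,A)$ be a finite simple digraph with at least one vertex. Then $\{v\}$ is a zero forcing set of $D$ for every $v\in V$ if and only if $D$ is a directed cycle.
   Context: A finite simple digraph $D=(V,A)$ has finite nonempty vertex set $V$ and arc set $A$ consisting of ordered pairs of distinct vertices (no loops, no parallel arcs; both $(u,v)$ and $(v,u)$ may be present). $N_D^+(v)=\{u:(v,u)\in A\}$. Zero forcing: for $S\subseteq V$ let $B^0(S)=S$ and $B^{i+1}(S)=B^i(S)\cup\{w:\{w\}=N_D^+(v)\setminus B^i(S)\text{ for some }v\in B^i(S)\}$. $S$ is a zero forcing set (ZFS) if $B^t(S)=V$ for some $t\ge 0$. $D$ is a directed cycle if its vertices can be labeled $v_1,\dots,v_n$ so that its arcs are exactly $(v_1,v_2),(v_2,v_3),\dots,(v_{n-1},v_n),(v_n,v_1)$, where $n\ge 2$ (for $n=2$ this is the digraph with both arcs between two vertices); by convention the digraph with a single vertex and no arcs also counts as a directed cycle. -}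

module Defs where

open import Data.Fin.Base using (Fin; zero; suc; fromℕ; inject₁)
open import Data.Nat.Base using (ℕ; zero; suc; _≤_; NonZero)
open import Data.Product.Base using (_×_; ∃-syntax)
open import Data.Sum.Base using (_⊎_)
open import Function.Bundles using (_↔_; _⇔_; Inverse)
open import Level using (0ℓ)
open import Relation.Binary.Core using (Rel)
open import Relation.Binary.Definitions using (Decidable)
open import Relation.Binary.PropositionalEquality.Core using (_≡_)
open import Relation.Nullary.Negation.Core using (¬_)
open import Relation.Unary using (Pred; U; _∈_; _∪_; _∖_; ｛_｝; _≐_)

-- The arc set is a decidable relation, so at most one arc joins an ordered
-- pair of vertices; arcs in both directions are allowed.
record Digraph : Set₁ where
  infix 4 _⟶_ _⟶?_
  field
    V        : Set
    order    : ℕ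
    finite   : Fin order ↔ V
    nonempty : NonZero order
    _⟶_      : Rel V 0ℓ
    _⟶?_     : Decidable _⟶_
    loopless : ∀ v → ¬ (v ⟶ v)

  N⁺ : V → Pred V 0ℓ
  N⁺ v u = v ⟶ u

module _ (D : Digraph) where
  open Digraph D

  Forced : Pred V 0ℓ → Pred V 0ℓ
  Forced B w = ∃[ v ] v ∈ B × ｛ w ｝ ≐ (N⁺ v ∖ B)

  B^ : ℕ → Pred V 0ℓ → Pred V 0ℓ
  B^ zero    S = S
  B^ (suc i) S = B^ i S ∪ Forced (B^ i S)

  IsZeroForcing : Pred V 0ℓ → Set
  IsZeroForcing S = ∃[ t ] B^ t S ≐ U

  -- With n = suc m labels ℓ 0, …, ℓ m, the pairs (ℓ i , ℓ (i + 1)) for i < m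
  -- together with the closing pair (ℓ m , ℓ 0).
  CycleArc : ∀ {m} → (Fin (suc m) → V) → Rel V 0ℓ
  CycleArc {m} ℓ x y =
    (∃[ i ] x ≡ ℓ (inject₁ i) × y ≡ ℓ (suc i)) ⊎ (x ≡ ℓ (fromℕ m) × y ≡ ℓ zero)

  data IsDirectedCycle : Set where
    single : (v : V) → (∀ u → u ≡ v) → (∀ x y → ¬ (x ⟶ y)) → IsDirectedCycle
    cycle  : ∀ m → 2 ≤ suc m → (ℓ : Fin (suc m) ↔ V) →
             (∀ x y → x ⟶ y ⇔ CycleArc (Inverse.to ℓ) x y) → IsDirectedCycle

{-# OPTIONS --safe #-}

-- If {v} forces some other vertex, then the first force is performed by v
-- itself, whose only out-neighbour is therefore the forced vertex.  So, with at
-- least two vertices, all singletons being zero forcing makes every out-degree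
-- equal to 1, and the arcs are the pairs (x , f x) for a function f.  For such a
-- digraph B^t({v}) consists of the iterates f^i(v) with i ≤ t, hence every
-- singleton is zero forcing iff every f-orbit is everything.  Then an initial
-- vertex returns to itself, and its iterates up to the least return time list
-- the digraph as a directed cycle.

module Submission where

open import Defs
open import Data.Empty using (⊥-elim)
open import Data.Fin.Base using (Fin; zero; suc; fromℕ; inject₁; toℕ)
open import Data.Fin.Induction using (<-weakInduction; >-weakInduction)
import Data.Fin.Properties as Fin
open import Data.Fin.Relation.Unary.Top
  using (view; view-fromℕ; view-inject₁; ‵fromℕ; ‵inject₁)
open import Data.Nat.Base using (ℕ; zero; suc; _+_; _∸_; _≤_; _<_; z≤n; s≤s; s≤s⁻¹)
open import Data.Nat.GeneralisedArithmetic using (fold; fold-+)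
open import Data.Nat.Induction using (<-rec)
open import Data.Nat.Properties
  using ( ≤-refl; m≤n⇒m≤1+n; m≤n⇒m<n∨m≡n; <-cmp; anyUpTo?; m∸n+n≡m; +-monoʳ-<
        ; +-monoˡ-≤; +-comm)
open import Data.Product.Base using (∃-syntax; _×_; _,_; proj₁; proj₂)
open import Data.Sum.Base using (_⊎_; inj₁; inj₂; [_,_]′)
open import Data.Unit.Base using (tt)
open import Function.Base using (_∘_; id)
open import Function.Bundles using (_⇔_; Equivalence; Inverse; mk⇔; mk⤖)
open import Function.Consequences.Propositional using (strictlySurjective⇒surjective)
open import Function.Definitions using (Injective; StrictlySurjective)
open import Function.Properties.Bijection using (⤖⇒↔)
open import Function.Properties.Inverse using (↔⇒↣; ↔-sym)
open import Relation.Binary.Definitions using (DecidableEquality; tri<; tri≈; tri>)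
open import Relation.Binary.PropositionalEquality
  using (_≡_; _≢_; refl; sym; trans; cong; subst; module ≡-Reasoning)
open import Relation.Nullary.Decidable using (yes; no; ¬?; via-injection; decidable-stable)
open import Relation.Nullary.Negation using (¬_)
open import Relation.Unary using (Decidable; ｛_｝; _∈_; _≐_)

open Equivalence using (to; from)

-- Least witnesses of decidable properties.

IsLeast : (ℕ → Set) → ℕ → Set
IsLeast P m = P m × (∀ {k} → k < m → ¬ P k)

least : ∀ {P : ℕ → Set} → Decidable P → ∀ n → P n → ∃[ m ] IsLeast P m
least {P} P? = <-rec _ search
  where
  search : ∀ n → (∀ {k} → k < n → P k → ∃[ m ] IsLeast P m) → P n → ∃[ m ] IsLeast P m
  search n rec Pn with anyUpTo? P? n
  ... | yes (k , k<n , Pk) = rec k<n Pk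
  ... | no none            = n , Pn , λ k<n Pk → none (_ , k<n , Pk)

-- Cyclic labellings on which a function acts as the shift.

next : ∀ {m} → Fin (suc m) → Fin (suc m)
next i with view i
... | ‵fromℕ     = zero
... | ‵inject₁ j = suc j

next-fromℕ : ∀ m → next (fromℕ m) ≡ zero
next-fromℕ m rewrite view-fromℕ m = refl

next-inject₁ : ∀ {m} (j : Fin m) → next (inject₁ j) ≡ suc j
next-inject₁ j rewrite view-inject₁ j = refl

Follows : ∀ {V : Set} {m} → (V → V) → (Fin (suc m) → V) → Set
Follows f ℓ = ∀ i → f (ℓ i) ≡ ℓ (next i)

module _ {V : Set} {f : V → V} {m} (ℓ : Fin (suc m) → V) (follows : Follows f ℓ) where

  fold-toℕ : ∀ i → fold (ℓ zero) f (toℕ i) ≡ ℓ i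
  fold-toℕ = <-weakInduction _ refl λ j ih → begin
    f (fold (ℓ zero) f (toℕ j))            ≡⟨ cong (f ∘ fold (ℓ zero) f) (Fin.toℕ-inject₁ j) ⟨
    f (fold (ℓ zero) f (toℕ (inject₁ j)))  ≡⟨ cong f ih ⟩
    f (ℓ (inject₁ j))                      ≡⟨ follows (inject₁ j) ⟩
    ℓ (next (inject₁ j))                   ≡⟨ cong ℓ (next-inject₁ j) ⟩
    ℓ (suc j)                              ∎
    where open ≡-Reasoning

  -- Downward induction: the last label wraps around in one step, and every other label needs one
  -- step more than its successor. Followed by `fold-toℕ`, this leads from any label to any other.
  reaches-zero : ∀ i → ∃[ k ] fold (ℓ i) f k ≡ ℓ zero
  reaches-zero = >-weakInduction _
    (1 , trans (follows _) (cong ℓ (next-fromℕ m)))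
    -- With `k + 1` rather than `suc k`, `fold-+` splits off the innermost application of `f`.
    λ j (k , eq) → k + 1 , (begin
      fold (ℓ (inject₁ j)) f (k + 1)    ≡⟨ fold-+ _ f k ⟩
      fold (f (ℓ (inject₁ j))) f k      ≡⟨ cong (λ x → fold x f k) (follows _) ⟩
      fold (ℓ (next (inject₁ j))) f k   ≡⟨ cong (λ x → fold (ℓ x) f k) (next-inject₁ j) ⟩
      fold (ℓ (suc j)) f k              ≡⟨ eq ⟩
      ℓ zero                            ∎)
    where open ≡-Reasoning

  -- The image of `ℓ` is closed under `f`. Hence `ℓ` is surjective once the orbit of `ℓ zero` is
  -- everything.
  orbit-in-image : ∀ n → ∃[ i ] ℓ i ≡ fold (ℓ zero) f n
  orbit-in-image zero    = zero , refl
  orbit-in-image (suc n) = let i , eq = orbit-in-image n in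
    next i , trans (sym (follows i)) (cong f eq)

-- Iterates up to the least return time.

module _ {V : Set} (_≟_ : DecidableEquality V) (f : V → V) (v : V) where

  -- The shift by `suc` rules out the trivial return at time 0 and makes `p` the last index of
  -- `Fin (suc p)`.
  LeastReturn : ℕ → Set
  LeastReturn = IsLeast (λ n → fold v f (suc n) ≡ v)

  least-return : ∀ n → fold v f (suc n) ≡ v → ∃[ p ] LeastReturn p
  least-return = least (λ n → fold v f (suc n) ≟ v)

  module _ {p} (leastReturn : LeastReturn p) where

    private
      return  = proj₁ leastReturn
      minimal = proj₂ leastReturn

    iterates : Fin (suc p) → V
    iterates i = fold v f (toℕ i)

    iterates-follows : Follows f iterates
    iterates-follows i with view i
    ... | ‵fromℕ     = trans (cong (fold v f ∘ suc) (Fin.toℕ-fromℕ p)) return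
    ... | ‵inject₁ j = cong (fold v f ∘ suc) (Fin.toℕ-inject₁ j)

    -- From f^i(v) = f^j(v) with i < j ≤ p, applying f^(p+1-j) to both sides
    -- gives a return to v before time p + 1.
    iterates-distinct : ∀ {i j} → i < j → j ≤ p → fold v f i ≢ fold v f j
    iterates-distinct {i} {j} i<j j≤p eq = minimal early (begin
      fold v f (suc (p ∸ j) + i)          ≡⟨ fold-+ v f (suc (p ∸ j)) ⟩
      fold (fold v f i) f (suc (p ∸ j))   ≡⟨ cong (λ x → fold x f (suc (p ∸ j))) eq ⟩
      fold (fold v f j) f (suc (p ∸ j))   ≡⟨ fold-+ v f (suc (p ∸ j)) ⟨
      fold v f (suc (p ∸ j) + j)          ≡⟨ cong (fold v f ∘ suc) (m∸n+n≡m j≤p) ⟩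
      fold v f (suc p)                    ≡⟨ return ⟩
      v                                   ∎)
      where
      open ≡-Reasoning
      early : p ∸ j + i < p
      early = subst (p ∸ j + i <_) (m∸n+n≡m j≤p) (+-monoʳ-< (p ∸ j) i<j)

    iterates-injective : Injective _≡_ _≡_ iterates
    iterates-injective {i} {j} eq with <-cmp (toℕ i) (toℕ j)
    ... | tri< i<j _ _ = ⊥-elim (iterates-distinct i<j (Fin.toℕ≤pred[n] j) eq)
    ... | tri≈ _ i≡j _ = Fin.toℕ-injective i≡j
    ... | tri> _ _ j<i = ⊥-elim (iterates-distinct j<i (Fin.toℕ≤pred[n] i) (sym eq))

module _ (D : Digraph) where
  open Digraph D

  infix 4 _≟_
  _≟_ : DecidableEquality V
  _≟_ = via-injection (↔⇒↣ (↔-sym finite)) Fin._≟_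

  -- As `next` sends the last index to `zero`, the closing arc needs no separate case.
  cycleArc⇔next : ∀ {m} (ℓ : Fin (suc m) → V) {x y} →
                  CycleArc D ℓ x y ⇔ (∃[ i ] x ≡ ℓ i × y ≡ ℓ (next i))
  cycleArc⇔next {m} ℓ {x} {y} = mk⇔ ltr rtl
    where
    ltr : CycleArc D ℓ x y → ∃[ i ] x ≡ ℓ i × y ≡ ℓ (next i)
    ltr (inj₁ (j , x≡ , y≡)) = inject₁ j , x≡ , trans y≡ (cong ℓ (sym (next-inject₁ j)))
    ltr (inj₂ (x≡ , y≡))     = fromℕ m , x≡ , trans y≡ (cong ℓ (sym (next-fromℕ m)))
    rtl : ∃[ i ] x ≡ ℓ i × y ≡ ℓ (next i) → CycleArc D ℓ x y
    rtl (i , x≡ , y≡) with view i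
    ... | ‵fromℕ     = inj₂ (x≡ , y≡)
    ... | ‵inject₁ j = inj₁ (j , x≡ , y≡)

  -- Forcing in the digraph of a function.

  IsSuccessor : (V → V) → Set
  IsSuccessor f = ∀ v → ｛ f v ｝ ≐ N⁺ v

  module _ {f : V → V} (succ : IsSuccessor f) where

    -- A vertex `x` can force only `f x`, so each round adds at most one to the exponents needed.
    B^⇒orbit : ∀ t {v u} → u ∈ B^ D t ｛ v ｝ → ∃[ i ] i ≤ t × fold v f i ≡ u
    B^⇒orbit zero v≡u = 0 , z≤n , v≡u
    B^⇒orbit (suc t) (inj₁ u∈B) =
      let i , i≤t , eq = B^⇒orbit t u∈B in i , m≤n⇒m≤1+n i≤t , eq
    B^⇒orbit (suc t) (inj₂ (x , x∈B , ⊆N , _)) =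
      let i , i≤t , eq = B^⇒orbit t x∈B in
      suc i , s≤s i≤t , trans (cong f eq) (proj₂ (succ x) (proj₁ (⊆N refl)))

    orbit⇒B^ : ∀ t {v i} → i ≤ t → fold v f i ∈ B^ D t ｛ v ｝
    orbit⇒B^ zero z≤n = refl
    orbit⇒B^ (suc t) {v} {i} i≤1+t with m≤n⇒m<n∨m≡n i≤1+t
    ... | inj₁ i<1+t = inj₁ (orbit⇒B^ t (s≤s⁻¹ i<1+t))
    -- A force needs a target outside the current set. The new iterate either repeats an earlier
    -- one, and is already present, or is absent by `B^⇒orbit` and is forced by its predecessor.
    ... | inj₂ refl with anyUpTo? (λ k → fold v f k ≟ fold v f (suc t)) (suc t)
    ...   | yes (k , k<1+t , eq) = inj₁ (subst (_∈ B^ D t ｛ v ｝) eq (orbit⇒B^ t (s≤s⁻¹ k<1+t)))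
    ...   | no new = inj₂
      ( fold v f t
      , orbit⇒B^ t ≤-refl
      , (λ { refl → proj₁ (succ _) refl
                  , λ w∈B → let k , k≤t , eq = B^⇒orbit t w∈B in new (k , s≤s k≤t , eq) })
      , λ (arc , _) → proj₂ (succ _) arc )

  -- From directed cycles to zero forcing.

  cycle⇒zeroForcing : IsDirectedCycle D → ∀ v → IsZeroForcing D ｛ v ｝
  cycle⇒zeroForcing (single r all≡r _) v =
    0 , (λ _ → tt) , λ {u} _ → trans (all≡r v) (sym (all≡r u))
  cycle⇒zeroForcing (cycle m _ ℓ↔ arcs) v =
    -- It takes `k` steps from `v` to `ℓ zero`, and at most `m` more to any label.
    m + k , (λ _ → tt) , λ {u} _ → subst (_∈ B^ D (m + k) ｛ v ｝) (reach u)
      (orbit⇒B^ succ (m + k) (+-monoˡ-≤ k (Fin.toℕ≤pred[n] (ℓ⁻¹ u))))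
    where
    open Inverse ℓ↔ renaming (to to ℓ; from to ℓ⁻¹)
    open ≡-Reasoning

    f : V → V
    f = ℓ ∘ next ∘ ℓ⁻¹

    follows : Follows f ℓ
    follows i = cong (ℓ ∘ next) (strictlyInverseʳ i)

    succ : IsSuccessor f
    succ x =
      (λ { refl → from (arcs x _) (from (cycleArc⇔next ℓ) (ℓ⁻¹ x , sym (strictlyInverseˡ x) , refl)) })
      , λ {y} arc → let i , x≡ , y≡ = to (cycleArc⇔next ℓ) (to (arcs x y) arc) in
          trans (cong f x≡) (trans (follows i) (sym y≡))

    k : ℕ
    k = proj₁ (reaches-zero ℓ follows (ℓ⁻¹ v))

    reach : ∀ u → fold v f (toℕ (ℓ⁻¹ u) + k) ≡ u
    reach u = begin
      fold v f (toℕ (ℓ⁻¹ u) + k)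
        ≡⟨ cong (λ x → fold x f (toℕ (ℓ⁻¹ u) + k)) (strictlyInverseˡ v) ⟨
      fold (ℓ (ℓ⁻¹ v)) f (toℕ (ℓ⁻¹ u) + k)
        ≡⟨ fold-+ _ f (toℕ (ℓ⁻¹ u)) ⟩
      fold (fold (ℓ (ℓ⁻¹ v)) f k) f (toℕ (ℓ⁻¹ u))
        ≡⟨ cong (λ x → fold x f (toℕ (ℓ⁻¹ u))) (proj₂ (reaches-zero ℓ follows (ℓ⁻¹ v))) ⟩
      fold (ℓ zero) f (toℕ (ℓ⁻¹ u))
        ≡⟨ fold-toℕ ℓ follows (ℓ⁻¹ u) ⟩
      ℓ (ℓ⁻¹ u)
        ≡⟨ strictlyInverseˡ u ⟩
      u ∎

  -- From zero forcing to directed cycles.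

  first-force : ∀ t {v u} → u ∈ B^ D t ｛ v ｝ → v ≡ u ⊎ (∃[ w ] ｛ w ｝ ≐ N⁺ v)
  first-force zero    v≡u        = inj₁ v≡u
  first-force (suc t) (inj₁ u∈B) = first-force t u∈B
  -- Trace the force back through `x`: either the out-neighbourhood of `v` is already known to be a
  -- singleton, or `x` is `v` and it remains to exclude out-neighbours other than `u`.
  first-force (suc t) {v} {u} (inj₂ (x , x∈B , ⊆N , N⊆)) with first-force t x∈B
  ... | inj₂ found = inj₂ found
  ... | inj₁ refl  = inj₂ (u , (λ { refl → v⟶u })
                             , λ {y} arc → decidable-stable (u ≟ y) λ u≢y →
                                 u≢y (N⊆ (arc , unforced arc u≢y)))
    where
    v⟶u : v ⟶ u
    v⟶u = proj₁ (⊆N refl)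
    -- By induction, if `y` were already present, then `y` would be `v`, giving a loop, or `v` would
    -- have a single out-neighbour, so that `u` and `y` would agree.
    unforced : ∀ {y} → v ⟶ y → u ≢ y → ¬ y ∈ B^ D t ｛ v ｝
    unforced arc u≢y y∈B with first-force t y∈B
    ... | inj₁ refl           = loopless v arc
    ... | inj₂ (w , _ , N⊆w) = u≢y (trans (sym (N⊆w v⟶u)) (N⊆w arc))

  module _ (forcing : ∀ v → IsZeroForcing D ｛ v ｝) where

    reached : ∀ v u → u ∈ B^ D (proj₁ (forcing v)) ｛ v ｝
    reached v u = proj₂ (proj₂ (forcing v)) tt

    outNeighbour : ∀ {u v} → v ≢ u → ∃[ w ] ｛ w ｝ ≐ N⁺ v
    outNeighbour {u} {v} v≢u = [ ⊥-elim ∘ v≢u , id ]′ (first-force (proj₁ (forcing v)) (reached v u))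

    successor⇒cycle : ∀ {f} → IsSuccessor f → V → IsDirectedCycle D
    successor⇒cycle {f} succ v =
      cycle p (2≤ (proj₁ leastReturn))
        (⤖⇒↔ (mk⤖ ( iterates-injective _≟_ f v leastReturn
                   , strictlySurjective⇒surjective surj )))
        arcs
      where
      orbit-all : ∀ x u → ∃[ i ] fold x f i ≡ u
      orbit-all x u = let i , _ , eq = B^⇒orbit succ (proj₁ (forcing x)) (reached x u) in i , eq

      return : ∃[ n ] fold v f (suc n) ≡ v
      -- Starting from `f v` makes the return time positive.
      return = let n , eq = orbit-all (f v) v in
        n , trans (cong (fold v f) (+-comm 1 n)) (trans (fold-+ v f n {1}) eq)

      minimum : ∃[ p ] LeastReturn _≟_ f v p
      minimum = least-return _≟_ f v (proj₁ return) (proj₂ return)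

      p           = proj₁ minimum
      leastReturn = proj₂ minimum

      2≤ : ∀ {p} → fold v f (suc p) ≡ v → 2 ≤ suc p
      -- A return after one step would be a loop at `v`.
      2≤ {zero}  eq = ⊥-elim (loopless v (proj₁ (succ v) eq))
      2≤ {suc _} _  = s≤s (s≤s z≤n)

      ℓ : Fin (suc p) → V
      ℓ = iterates _≟_ f v leastReturn

      follows : Follows f ℓ
      follows = iterates-follows _≟_ f v leastReturn

      surj : StrictlySurjective _≡_ ℓ
      surj u = let n , eq = orbit-all v u
                   i , eq′ = orbit-in-image ℓ follows n in
        i , trans eq′ eq

      arcs : ∀ x y → x ⟶ y ⇔ CycleArc D ℓ x y
      arcs x y = mk⇔
        (λ arc → let i , eq = surj x in
          from (cycleArc⇔next ℓ) (i , sym eq ,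
            trans (sym (proj₂ (succ x) arc)) (trans (cong f (sym eq)) (follows i))))
        λ ca → let i , x≡ , y≡ = to (cycleArc⇔next ℓ) ca in
          proj₁ (succ x) (trans (cong f x≡) (trans (follows i) (sym y≡)))

    zeroForcing⇒cycle : V → IsDirectedCycle D
    zeroForcing⇒cycle r
      -- Finiteness decides whether there is a vertex other than `r`.
      with Fin.any? (λ i → ¬? (r ≟ Inverse.to finite i))
    ... | yes (i , r≢u) = successor⇒cycle (proj₂ ∘ out) r
      where
      u = Inverse.to finite i
      out : ∀ v → ∃[ w ] ｛ w ｝ ≐ N⁺ v
      -- `outNeighbour` needs some vertex different from `v`: `r` serves unless `v` is `r`, and then
      -- `u` does.
      out v with v ≟ r
      ... | yes refl = outNeighbour r≢u
      ... | no v≢r   = outNeighbour v≢r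
    ... | no none = single r (sym ∘ r≡) λ x y arc →
            loopless r (subst (r ⟶_) (sym (r≡ y)) (subst (_⟶ y) (sym (r≡ x)) arc))
      where
      r≡ : ∀ u → r ≡ u
      r≡ u = decidable-stable (r ≟ u) λ r≢u →
        none (Inverse.from finite u , r≢u ∘ λ eq → trans eq (Inverse.strictlyInverseˡ finite u))

  vertex : V
  vertex with order | nonempty | finite
  ... | suc _ | _ | fin = Inverse.to fin zero

corollary2p5 : (D : Digraph) → (∀ (v : Digraph.V D) → IsZeroForcing D ｛ v ｝) ⇔ IsDirectedCycle D
corollary2p5 D = mk⇔ (λ forcing → zeroForcing⇒cycle D forcing (vertex D)) (cycle⇒zeroForcing D)
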